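{- Let $n\ge2$, $v\in\tilde{S}_n$ and $r\in\mathbb{Z}$. Let $R(\Psi^+_r(v))$ denote the set of all reduced words of all elements of $\Psi^+_r(v)$ and $R(\Psi^-_r(v))$ the set of all reduced words of all elements of $\Psi^-_r(v)$, each reduced word $a$ of an element $w\gtrdot v$ being regarded as the reduced $v$-marked word $(a,i)$ with $i$ the unique index such that deleting $a_i$ gives a reduced word of $v$. Then the map $\phi^v$ restricts to a bijection $\phi^v_r: R(\Psi^+_r(v))\to R(\Psi^-_r(v))$.
   Context: $\tilde{S}_n$ is the affine symmetric group: bijections $w:\mathbb{Z}\to\mathbb{Z}$ with $w(i+n)=w(i)+n$ and $\sum_{i=1}^n w(i)=\sum_{i=1}^n i$, a Coxeter group with simple reflections $s_0,\dots,s_{n-1}$ ($s_i$ swaps $i+kn$ and $i+1+kn$ for all $k$). For $r\not\equiv s\pmod n$, $t_{r,s}$ is the unique element swapping $r$ and $s$ and fixing every integer not congruent to $r$ or $s$ mod $n$. $\ell$ is Coxeter length, $R(w)$ the set of reduced words of $w$ (words in letters $\{0,\dots,n-1\}$). $v\lessdot w$ means $w=vt_{p,q}$ for some reflection $t_{p,q}$ and $\ell(w)=\ell(v)+1$. $\Psi^+_r(v)$ is the set of $w$ with $v\lessdot w$ and $w=vt_{r,s}$ for some $s>r$; $\Psi^-_r(v)$ is the set of $w$ with $v\lessdot w$ and $w=vt_{s,r}$ for some $s<r$. (For $w\gtrdot v$ and $a\in R(w)$ there is a unique index $i$ such that deleting $a_i$ gives a word in $R(v)$.) A $v$-marked word is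 a pair $(a,i)$ with $a=a_1\cdots a_l$ a word in letters $\{0,\dots,n-1\}$ and $i\in[1,l]$ such that $a_1\cdots\widehat{a_i}\cdots a_l\in R(v)$; it is reduced if $a$ is a reduced word. The affine Little graph has the $v$-marked words as vertices and, from each $(a,i)$, a unique edge $(a,i)\to(a',j)$, where $a'$ is obtained from $a$ by replacing $a_i$ by $a_i-1$ (mod $n$), and $j=i$ if $a'$ is reduced, while otherwise $j$ is the unique index $j\ne i$ with $a'_1\cdots\widehat{a'_j}\cdots a'_l\in R(v)$ (which exists and is unique). Every vertex has exactly one incoming edge, so the components are finite directed cycles. For a reduced $v$-marked word $(a,i)$, $\phi^v(a,i)$ is the first reduced $v$-marked word strictly after $(a,i)$ along its cycle. -}

module Defs where

open import Data.Fin.Base using (Fin; zero; suc; toℕ; fromℕ; inject₁)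
open import Data.Integer.Base using (ℤ; +_; 1ℤ; _+_; _-_; _<_)
open import Data.Integer.Divisibility.Signed using (_∣_; _∣?_)
open import Data.Integer.Properties using (+-0-commutativeMonoid)
open import Data.List.Base using (List; []; _∷_; length; removeAt; _[_]%=_)
open import Data.Nat.Base as ℕ using (ℕ)
open import Data.Product using (∃; ∃₂; ∃!; _×_; _,_; proj₁)
open import Function.Base using (_∘_; id)
open import Function.Definitions using (Bijective)
open import Level using (0ℓ)
open import Relation.Binary.Bundles using (Setoid)
import Relation.Binary.Construct.On as On
open import Relation.Binary.PropositionalEquality
  using (_≡_; _≢_; _≗_; setoid)
open import Relation.Nullary using (¬_; yes; no)
open import Relation.Unary using (Pred)

open import Algebra.Properties.CommutativeMonoid.Sum +-0-commutativeMonoid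
  using (sum)

_≡_[mod_] : ℤ → ℤ → ℕ → Set
x ≡ y [mod n ] = + n ∣ (x - y)

-- Elements are compared by pointwise equality (_≗_) of `fun`; the group
-- operation is composition of functions.
record Affine (n : ℕ) : Set where
  field
    fun       : ℤ → ℤ
    bijective : Bijective _≡_ _≡_ fun
    periodic  : ∀ i → fun (i + + n) ≡ fun i + + n
    balanced  : sum {n} (λ k → fun (+ ℕ.suc (toℕ k))) ≡ sum {n} (λ k → + ℕ.suc (toℕ k))

open Affine public

-- s i swaps i + kn and i + 1 + kn for every k.
s : ∀ {n} → Fin n → ℤ → ℤ
s {n} i m with + n ∣? (m - + toℕ i) | + n ∣? (m - (+ toℕ i + 1ℤ))
... | yes _ | _     = m + 1ℤ
... | no  _ | yes _ = m - 1ℤ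
... | no  _ | no  _ = m

-- t is t_{p,q}, which is defined only for p ≢ q (mod n).
record IsReflection {n : ℕ} (t : Affine n) (p q : ℤ) : Set where
  field
    distinct : ¬ p ≡ q [mod n ]
    swapˡ    : fun t p ≡ q
    swapʳ    : fun t q ≡ p
    fixes    : ∀ m → ¬ m ≡ p [mod n ] → ¬ m ≡ q [mod n ] → fun t m ≡ m

_≈_·t[_,_] : ∀ {n} → Affine n → Affine n → ℤ → ℤ → Set
_≈_·t[_,_] {n} w v p q =
  ∃ λ (t : Affine n) → IsReflection t p q × fun w ≗ fun v ∘ fun t

Word : ℕ → Set
Word n = List (Fin n)

⟦_⟧ : ∀ {n} → Word n → ℤ → ℤ
⟦ []    ⟧ = id
⟦ i ∷ a ⟧ = s i ∘ ⟦ a ⟧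

Reduced : ∀ {n} → Word n → Set
Reduced {n} a = ∀ (b : Word n) → ⟦ b ⟧ ≗ ⟦ a ⟧ → length a ℕ.≤ length b

_∈R_ : ∀ {n} → Word n → Affine n → Set
a ∈R w = ⟦ a ⟧ ≗ fun w × Reduced a

HasLength : ∀ {n} → Affine n → ℕ → Set
HasLength w k = ∃ λ a → a ∈R w × length a ≡ k

_⋖_ : ∀ {n} → Affine n → Affine n → Set
v ⋖ w = (∃₂ λ p q → w ≈ v ·t[ p , q ])
      × (∃ λ k → HasLength v k × HasLength w (ℕ.suc k))

Ψ⁺ Ψ⁻ : ∀ {n} → Affine n → ℤ → Pred (Affine n) 0ℓ
Ψ⁺ v r w = v ⋖ w × (∃ λ q → r < q × w ≈ v ·t[ r , q ])
Ψ⁻ v r w = v ⋖ w × (∃ λ q → q < r × w ≈ v ·t[ q , r ])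

-- The set R(P) of all reduced words of elements of P; its elements are
-- compared as words only.
R : ∀ {n} → Pred (Affine n) 0ℓ → Setoid 0ℓ 0ℓ
R {n} P = On.setoid (setoid (Word n)) (proj₁ {B = λ a → ∃ λ w → P w × a ∈R w})

record MarkedWord {n : ℕ} (v : Affine n) : Set where
  constructor mkMarked
  field
    word   : Word n
    idx    : Fin (length word)
    marked : removeAt word idx ∈R v

open MarkedWord public

_≈ₘ_ : ∀ {n} {v : Affine n} → MarkedWord v → MarkedWord v → Set
x ≈ₘ y = word x ≡ word y × toℕ (idx x) ≡ toℕ (idx y)

lower : ∀ {n} → Fin n → Fin n
lower {ℕ.suc n} zero    = fromℕ n
lower           (suc i) = inject₁ i

-- That y is a v-marked word is part of its type, so `moves` says that the
-- new mark is an index other than the old one whose deletion gives a word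
-- in R(v).
record _⟶_ {n : ℕ} {v : Affine n} (x y : MarkedWord v) : Set where
  field
    bumps : word y ≡ word x [ idx x ]%= lower
    stays : Reduced (word y) → toℕ (idx y) ≡ toℕ (idx x)
    moves : ¬ Reduced (word y) → toℕ (idx y) ≢ toℕ (idx x)

-- φ x y is the graph of φ^v: y is the first reduced v-marked word strictly
-- after x along the path starting at x.
data φ {n : ℕ} {v : Affine n} (x y : MarkedWord v) : Set where
  stop : x ⟶ y → Reduced (word y) → φ x y
  step : ∀ {z} → x ⟶ z → ¬ Reduced (word z) → φ z y → φ x y

UniquelyMarked : ∀ {n} → Affine n → Pred (Affine n) 0ℓ → Set
UniquelyMarked v P =
  ∀ ((a , _) : Setoid.Carrier (R P)) → ∃! _≡_ λ i → removeAt a i ∈R v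

regard : ∀ {n} {v : Affine n} {P : Pred (Affine n) 0ℓ} →
         UniquelyMarked v P → Setoid.Carrier (R P) → MarkedWord v
regard m a@(word , _) = let (i , marked , _) = m a in mkMarked word i marked

{-# OPTIONS --safe #-}
module Submission where

-- Follow wires through a word: the letter a_i crosses two wires, a lower one lo
-- and an upper one hi, and deleting a_i multiplies by t_{lo,hi} on the right.
-- A word is reduced iff lo < hi at every letter, so a reduced marked word lies
-- over Ψ⁺_r iff lo ≡ r at its mark, and over Ψ⁻_r iff hi ≡ r. Lowering the
-- marked letter turns its lower wire into the upper one. If the new word is not
-- reduced, the same two wires cross at exactly one other mark, in the opposite
-- order, so the lower wire is r again; hence r is lower at every step until a
-- reduced word appears, and is upper there. Each step is injective on a finite
-- set, so its orbits are cycles, which gives existence and surjectivity.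

open import Defs
open import Data.Fin.Base using (Fin; zero; suc; toℕ; fromℕ; inject₁; cast; combine)
import Data.Fin.Properties as Fin
open import Data.Integer.Base as ℤ
  using (ℤ; +_; -[1+_]; 0ℤ; 1ℤ; _+_; _-_; -_; _*_; _<_)
open import Data.Integer.Divisibility.Signed using (_∣?_; divides; ∣⇒∣ᵤ)
import Data.Integer.Properties as ℤ
open import Data.Integer.Tactic.RingSolver using (solve-∀)
open import Data.List.Base using (List; []; _∷_; length; removeAt; _ʳ++_; _[_]%=_)
open import Data.List.Properties using (length-removeAt′; length-%=; ∷-injectiveˡ; ∷-injectiveʳ)
open import Data.Nat.Base as ℕ using (ℕ; _≤_; s≤s; z≤n)
import Data.Nat.Divisibility as ℕ
import Data.Nat.Properties as ℕ
open import Data.Product.Base using (Σ-syntax; ∃; ∃₂; _×_; _,_; proj₁; proj₂)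
open import Data.Sum.Base using (_⊎_; inj₁; inj₂)
open import Function.Base using (_∘_; id)
open import Function.Bundles using (Bijection; _⇔_; mk⇔)
open import Relation.Binary.Bundles using (Setoid)
open import Relation.Binary.Definitions using (tri<; tri≈; tri>)
open import Relation.Binary.PropositionalEquality
open import Relation.Nullary using (¬_; Dec; yes; no; contradiction)

open import Algebra.Properties.AbelianGroup ℤ.+-0-abelianGroup using (∙-cancelˡ; ∙-cancelʳ)
open import Algebra.Properties.CommutativeMonoid.Sum ℤ.+-0-commutativeMonoid
  using (sum; sum-cong-≗; sum-init-last)

-- Sums, lowered letters and a finite code for words.

sum-swap : ∀ {n} → 2 ≤ n → (f g : ℕ → ℤ) → f 0 ≡ g 1 → f 1 ≡ g 0 →
           (∀ k → 2 ≤ k → k ℕ.< n → f k ≡ g k) →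
           sum {n} (f ∘ toℕ) ≡ sum {n} (g ∘ toℕ)
sum-swap {ℕ.suc (ℕ.suc n)} (s≤s (s≤s _)) f g e₀ e₁ e = begin
  f 0 + (f 1 + sum f₂)  ≡⟨ cong₂ _+_ e₀ (cong₂ _+_ e₁ (sum-cong-≗ λ k → e _ (s≤s (s≤s z≤n)) (s≤s (s≤s (Fin.toℕ<n k))))) ⟩
  g 1 + (g 0 + sum g₂)  ≡⟨ lemma (g 1) (g 0) (sum g₂) ⟩
  g 0 + (g 1 + sum g₂)  ∎
  where
  open ≡-Reasoning
  f₂ g₂ : Fin n → ℤ
  f₂ k = f (ℕ.suc (ℕ.suc (toℕ k)))
  g₂ k = g (ℕ.suc (ℕ.suc (toℕ k)))
  lemma : ∀ x y z → x + (y + z) ≡ y + (x + z)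
  lemma = solve-∀

lower-injective : ∀ {n} {x y : Fin n} → lower x ≡ lower y → x ≡ y
lower-injective {x = zero}  {zero}  _ = refl
lower-injective {x = zero}  {suc y} e = contradiction e Fin.fromℕ≢inject₁
lower-injective {x = suc x} {zero}  e = contradiction (sym e) Fin.fromℕ≢inject₁
lower-injective {x = suc x} {suc y} e = cong suc (Fin.inject₁-injective e)

updateAt-injective : ∀ {ℓ} {A : Set ℓ} {f : A → A} → (∀ {x y} → f x ≡ f y → x ≡ y) →
                     ∀ (a b : List A) i j → toℕ i ≡ toℕ j →
                     a [ i ]%= f ≡ b [ j ]%= f → a ≡ b
updateAt-injective inj (x ∷ a) (y ∷ b) zero    zero    _ e =
  cong₂ _∷_ (inj (∷-injectiveˡ e)) (∷-injectiveʳ e)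
updateAt-injective inj (x ∷ a) (y ∷ b) (suc i) (suc j) i≡j e =
  cong₂ _∷_ (∷-injectiveˡ e) (updateAt-injective inj a b i j (ℕ.suc-injective i≡j) (∷-injectiveʳ e))

-- The length is a separate parameter with its own proof, so that all words along one orbit are
-- coded in the same finite set.
encode : ∀ {n} (a : Word n) l → length a ≡ l → Fin (n ℕ.^ l)
encode []      ℕ.zero    _ = zero
encode (x ∷ a) (ℕ.suc l) e = combine x (encode a l (ℕ.suc-injective e))

encode-injective : ∀ {n} (a b : Word n) l e e′ → encode a l e ≡ encode b l e′ → a ≡ b
encode-injective []      []      ℕ.zero    _ _  _  = refl
encode-injective (x ∷ a) (y ∷ b) (ℕ.suc l) e e′ eq =
  let x≡y , eq′ = Fin.combine-injective x _ y _ eq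
  in cong₂ _∷_ x≡y (encode-injective a b l _ _ eq′)

-- Congruence modulo `n` and equivariant maps.

module AffineWords (n : ℕ) (2≤n : 2 ≤ n) where

  private
    N : ℤ
    N = + n

  Equivariant : (ℤ → ℤ) → Set
  Equivariant f = ∀ m k → f (m + k * N) ≡ f m + k * N

  infix 4 _≋_

  -- Congruence modulo `n`, with the difference already solved for `x`: matching on `refl` then
  -- replaces `x` by `y` plus a multiple of `n`.
  record _≋_ (x y : ℤ) : Set where
    constructor by
    field
      turns : ℤ
      shift : x ≡ y + turns * N

  mod⇒≋ : ∀ {x y} → x ≡ y [mod n ] → x ≋ y
  mod⇒≋ {x} {y} (divides k eq) = by k (trans (lemma x y) (cong (_+_ y) eq))
    where
    lemma : ∀ x y → x ≡ y + (x - y)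
    lemma = solve-∀

  ≋⇒mod : ∀ {x y} → x ≋ y → x ≡ y [mod n ]
  ≋⇒mod {y = y} (by k refl) = divides k (lemma y (k * N))
    where
    lemma : ∀ y z → y + z - y ≡ z
    lemma = solve-∀

  unshift : ∀ {x y} k → x ≡ y + k * N → y ≡ x + (- k) * N
  unshift {y = y} k refl = lemma y k N
    where
    lemma : ∀ y k N → y ≡ y + k * N + (- k) * N
    lemma = solve-∀

  shift-shift : ∀ x j k → x + j * N + k * N ≡ x + (j + k) * N
  shift-shift x j k = lemma x j k N
    where
    lemma : ∀ x j k N → x + j * N + k * N ≡ x + (j + k) * N
    lemma = solve-∀

  ≋-sym : ∀ {x y} → x ≋ y → y ≋ x
  ≋-sym (by k eq) = by (- k) (unshift k eq)

  ≋-trans : ∀ {x y z} → x ≋ y → y ≋ z → x ≋ z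
  ≋-trans {z = z} (by k refl) (by j refl) = by (j + k) (shift-shift z j k)

  fun-equivariant : (t : Affine n) → Equivariant (fun t)
  fun-equivariant t m (+ k) = go k
    where
    lemma : ∀ x k N → x + (1ℤ + k) * N ≡ x + k * N + N
    lemma = solve-∀
    go : ∀ k → fun t (m + + k * N) ≡ fun t m + + k * N
    go ℕ.zero    = trans (cong (fun t) (ℤ.+-identityʳ m)) (sym (ℤ.+-identityʳ _))
    go (ℕ.suc k) = begin
      fun t (m + + ℕ.suc k * N)     ≡⟨ cong (fun t) (lemma m (+ k) N) ⟩
      fun t (m + + k * N + N)       ≡⟨ periodic t _ ⟩
      fun t (m + + k * N) + N       ≡⟨ cong (_+ N) (go k) ⟩
      fun t m + + k * N + N         ≡⟨ lemma (fun t m) (+ k) N ⟨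
      fun t m + + ℕ.suc k * N       ∎
      where open ≡-Reasoning
  fun-equivariant t m -[1+ k ] = begin
    fun t m′                                   ≡⟨ lemma (fun t m′) (+ ℕ.suc k) N ⟨
    fun t m′ + + ℕ.suc k * N + -[1+ k ] * N    ≡⟨ cong (_+ -[1+ k ] * N) (fun-equivariant t m′ (+ ℕ.suc k)) ⟨
    fun t (m′ + + ℕ.suc k * N) + -[1+ k ] * N  ≡⟨ cong (λ x → fun t x + -[1+ k ] * N) (lemma′ m (+ ℕ.suc k) N) ⟩
    fun t m + -[1+ k ] * N                     ∎
    where
    open ≡-Reasoning
    m′ : ℤ
    m′ = m + -[1+ k ] * N
    lemma : ∀ x k N → x + k * N + (- k) * N ≡ x
    lemma = solve-∀
    lemma′ : ∀ x k N → x + (- k) * N + k * N ≡ x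
    lemma′ = solve-∀

  -- The reflections t_{p,q} as maps on the integers.

  data SwapView (p q m x : ℤ) : Set where
    left  : ∀ k → m ≡ p + k * N → x ≡ q + k * N → SwapView p q m x
    right : ∀ k → m ≡ q + k * N → x ≡ p + k * N → SwapView p q m x
    fixed : ¬ (m ≋ p) → ¬ (m ≋ q) → x ≡ m → SwapView p q m x

  -- Says that `f` acts as t_{p,q}, for a bare function, so that it applies to `⟦ a ⟧` before that
  -- is known to lie in the group. In `SwapView` one `k` serves both equations, which builds in
  -- equivariance.
  record Swaps (f : ℤ → ℤ) (p q : ℤ) : Set where
    field
      distinct : ¬ (p ≋ q)
      view     : ∀ m → SwapView p q m (f m)

  open Swaps
  open _⟶_

  shift-cancel : ∀ p j k q → p + j * N ≡ p + k * N → q + j * N ≡ q + k * N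
  shift-cancel p j k q eq = cong (_+_ q) (∙-cancelˡ p (j * N) (k * N) eq)

  -- The three classes exclude one another because `p` and `q` are incongruent, and within one class
  -- the multiple of `n` cancels. The identities for reflections below come from comparing two views
  -- of one point.
  view-unique : ∀ {p q m x y} → ¬ (p ≋ q) →
                SwapView p q m x → SwapView p q m y → x ≡ y
  view-unique {p} {q} _ (left j e e₁) (left k e′ e₂) =
    trans e₁ (trans (shift-cancel p j k q (trans (sym e) e′)) (sym e₂))
  view-unique {p} {q} _ (right j e e₁) (right k e′ e₂) =
    trans e₁ (trans (shift-cancel q j k p (trans (sym e) e′)) (sym e₂))
  view-unique d (left j e _) (right k e′ _) =
    contradiction (≋-trans (≋-sym (by j e)) (by k e′)) d
  view-unique d (right j e _) (left k e′ _) =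
    contradiction (≋-trans (≋-sym (by k e′)) (by j e)) d
  view-unique d (left j e _)  (fixed ¬p _ _) = contradiction (by j e) ¬p
  view-unique d (right j e _) (fixed _ ¬q _) = contradiction (by j e) ¬q
  view-unique d (fixed ¬p _ _) (left j e _)  = contradiction (by j e) ¬p
  view-unique d (fixed _ ¬q _) (right j e _) = contradiction (by j e) ¬q
  view-unique d (fixed _ _ e) (fixed _ _ e′) = trans e (sym e′)

  view-sym : ∀ {p q m x} → SwapView p q m x → SwapView q p m x
  view-sym (left k e e′)    = right k e e′
  view-sym (right k e e′)   = left k e e′
  view-sym (fixed ¬p ¬q eq) = fixed ¬q ¬p eq

  view-inverse : ∀ {p q m x} → SwapView p q m x → SwapView p q x m
  view-inverse (left k e e′)      = right k e′ e
  view-inverse (right k e e′)     = left k e′ e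
  view-inverse (fixed ¬p ¬q refl) = fixed ¬p ¬q refl

  view-shift : ∀ {p q m x} j → SwapView p q m x → SwapView p q (m + j * N) (x + j * N)
  view-shift {p} {q} j (left k refl refl)  = left (k + j) (shift-shift p k j) (shift-shift q k j)
  view-shift {p} {q} j (right k refl refl) = right (k + j) (shift-shift q k j) (shift-shift p k j)
  view-shift j (fixed ¬p ¬q refl) =
    fixed (¬p ∘ ≋-trans (≋-sym (by j refl)))
          (¬q ∘ ≋-trans (≋-sym (by j refl))) refl

  swaps-unique : ∀ {f g p q} → Swaps f p q → Swaps g p q → f ≗ g
  swaps-unique f g m = view-unique (distinct f) (view f m) (view g m)

  swaps-cong : ∀ {f g p q} → f ≗ g → Swaps f p q → Swaps g p q
  swaps-cong {p = p} {q} e f = record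
    { distinct = distinct f ; view = λ m → subst (SwapView p q m) (e m) (view f m) }

  swaps-left : ∀ {f p q} → Swaps f p q → f p ≡ q
  swaps-left {p = p} {q} f =
    view-unique (distinct f) (view f p) (left 0ℤ (sym (ℤ.+-identityʳ p)) (sym (ℤ.+-identityʳ q)))

  swaps-sym : ∀ {f p q} → Swaps f p q → Swaps f q p
  swaps-sym f = record { distinct = distinct f ∘ ≋-sym ; view = view-sym ∘ view f }

  swaps-right : ∀ {f p q} → Swaps f p q → f q ≡ p
  swaps-right = swaps-left ∘ swaps-sym

  swaps-involutive : ∀ {f p q} → Swaps f p q → ∀ m → f (f m) ≡ m
  swaps-involutive {f} t m =
    view-unique (distinct t) (view t (f m)) (view-inverse (view t m))

  swaps-equivariant : ∀ {f p q} → Swaps f p q → Equivariant f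
  swaps-equivariant f m k = view-unique (distinct f) (view f _) (view-shift k (view f m))

  -- With `h` inverse to `g` this is h t_{p,q} g = t_{h(p),h(q)}.
  swaps-conjugate : ∀ {f p q} g h → Swaps f p q → Equivariant g → Equivariant h →
                    (∀ m → g (h m) ≡ m) → (∀ m → h (g m) ≡ m) →
                    Swaps (h ∘ f ∘ g) (h p) (h q)
  swaps-conjugate {f} {p} {q} g h t g-eq h-eq gh hg = record
    { distinct = distinct t ∘ reflect
    ; view     = λ m → pull m (view t (g m))
    }
    where
    transport : ∀ {x y} k → x ≡ y + k * N → h x ≡ h y + k * N
    transport k e = trans (cong h e) (h-eq _ k)
    reflect : ∀ {x y} → h x ≋ h y → x ≋ y
    reflect {x} {y} (by k e′) = by k (begin
      x                ≡⟨ gh x ⟨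
      g (h x)          ≡⟨ cong g e′ ⟩
      g (h y + k * N)  ≡⟨ g-eq _ k ⟩
      g (h y) + k * N  ≡⟨ cong (_+ k * N) (gh y) ⟩
      y + k * N        ∎)
      where open ≡-Reasoning
    pull : ∀ m {x} → SwapView p q (g m) x → SwapView (h p) (h q) m (h x)
    pull m (left k e e′)  = left k (trans (sym (hg m)) (transport k e)) (transport k e′)
    pull m (right k e e′) = right k (trans (sym (hg m)) (transport k e)) (transport k e′)
    pull m (fixed ¬p ¬q e) =
      fixed (¬p ∘ reflect ∘ subst (_≋ h p) (sym (hg m)))
            (¬q ∘ reflect ∘ subst (_≋ h q) (sym (hg m)))
            (trans (cong h e) (hg m))

  -- The ambiguity in the indices of a reflection: t_{p,q} is unchanged when both move by the same
  -- multiple of `n`. Unlike two separate congruences, this preserves the order of the pair.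
  record Shifted (p q p′ q′ : ℤ) : Set where
    constructor by
    field
      turns  : ℤ
      shiftˡ : p′ ≡ p + turns * N
      shiftʳ : q′ ≡ q + turns * N

  shifted-sym : ∀ {p q p′ q′} → Shifted p q p′ q′ → Shifted p′ q′ p q
  shifted-sym (by k e e′) = by (- k) (unshift k e) (unshift k e′)

  shifted-trans : ∀ {p q p′ q′ p″ q″} →
                  Shifted p q p′ q′ → Shifted p′ q′ p″ q″ → Shifted p q p″ q″
  shifted-trans {p} {q} (by j refl refl) (by k refl refl) =
    by (j + k) (shift-shift p j k) (shift-shift q j k)

  shifted-swap : ∀ {p q p′ q′} → Shifted p q p′ q′ → Shifted q p q′ p′
  shifted-swap (by k e e′) = by k e′ e

  shifted⇒≋ : ∀ {p q p′ q′} → Shifted p q p′ q′ → p′ ≋ p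
  shifted⇒≋ (by k e _) = by k e

  shifted-< : ∀ {p q p′ q′} → Shifted p q p′ q′ → p < q → p′ < q′
  shifted-< (by k refl refl) = ℤ.+-monoˡ-< (k * N)

  view-unshift : ∀ {p q p′ q′ m x} → Shifted p q p′ q′ → SwapView p q m x → SwapView p′ q′ m x
  view-unshift {p} {q} {p′} {q′} (by j e e′) = go
    where
    lemma : ∀ p p′ k → p′ ≡ p + j * N → p + k * N ≡ p′ + (- j + k) * N
    lemma p p′ k e = trans (cong (_+ k * N) (unshift {p′} {p} j e)) (shift-shift p′ (- j) k)
    go : ∀ {m x} → SwapView p q m x → SwapView p′ q′ m x
    go (left k refl refl)  = left (- j + k) (lemma p p′ k e) (lemma q q′ k e′)
    go (right k refl refl) = right (- j + k) (lemma q q′ k e′) (lemma p p′ k e)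
    go (fixed ¬p ¬q eq)    = fixed (λ m≡p′ → ¬p (≋-trans m≡p′ (by j e)))
                                   (λ m≡q′ → ¬q (≋-trans m≡q′ (by j e′))) eq

  swaps-shift : ∀ {f p q p′ q′} → Shifted p q p′ q′ → Swaps f p q → Swaps f p′ q′
  swaps-shift σ@(by j e e′) f = record
    { distinct = λ p′≡q′ → distinct f
        (≋-trans (≋-sym (by j e)) (≋-trans p′≡q′ (by j e′)))
    ; view     = view-unshift σ ∘ view f
    }

  -- Evaluating `f` at `p′` decides: that point is not fixed, so it is congruent to `p` or to `q`,
  -- and its image then fixes the other index.
  swaps-same : ∀ {f p q p′ q′} → Swaps f p q → Swaps f p′ q′ →
               Shifted p q p′ q′ ⊎ Shifted q p p′ q′
  swaps-same {p′ = p′} f f′ with view f p′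
  ... | left k e e′  = inj₁ (by k e (trans (sym (swaps-left f′)) e′))
  ... | right k e e′ = inj₂ (by k e (trans (sym (swaps-left f′)) e′))
  ... | fixed _ _ e  =
    contradiction (by 0ℤ (trans (trans (sym e) (swaps-left f′)) (sym (ℤ.+-identityʳ _))))
                  (distinct f′)

  reflection-swaps : ∀ {t : Affine n} {p q} → IsReflection t p q → Swaps (fun t) p q
  reflection-swaps {t} {p} {q} r = record { distinct = R.distinct ∘ ≋⇒mod ; view = view′ }
    where
    module R = IsReflection r
    view′ : ∀ m → SwapView p q m (fun t m)
    view′ m with N ∣? (m - p) | N ∣? (m - q)
    ... | yes m≡p | _ = let by k e = mod⇒≋ m≡p in
      left k e (trans (cong (fun t) e) (trans (fun-equivariant t p k) (cong (_+ k * N) R.swapˡ)))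
    ... | no _ | yes m≡q = let by k e = mod⇒≋ m≡q in
      right k e (trans (cong (fun t) e) (trans (fun-equivariant t q k) (cong (_+ k * N) R.swapʳ)))
    ... | no m≢p | no m≢q = fixed (m≢p ∘ ≋⇒mod) (m≢q ∘ ≋⇒mod) (R.fixes m m≢p m≢q)

  swaps-reflection : ∀ {t : Affine n} {p q} → Swaps (fun t) p q → IsReflection t p q
  swaps-reflection {t} f = record
    { distinct = distinct f ∘ mod⇒≋
    ; swapˡ    = swaps-left f
    ; swapʳ    = swaps-right f
    ; fixes    = λ m m≢p m≢q →
        view-unique (distinct f) (view f m) (fixed (m≢p ∘ ≋⇒mod) (m≢q ∘ ≋⇒mod) refl)
    }

  -- Wires, crossings and deletion of a letter.

  unwind : Word n → ℤ → ℤ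
  unwind []      m = m
  unwind (x ∷ a) m = unwind a (s x m)

  -- Wires are numbered by their positions at the right end of the word, so a
  -- pair (lo, hi) is canonical only up to a common multiple of n.
  lo hi : (a : Word n) → Fin (length a) → ℤ
  lo (x ∷ a) zero    = unwind a (+ toℕ x)
  lo (x ∷ a) (suc i) = lo a i
  hi (x ∷ a) zero    = unwind a (+ toℕ x + 1ℤ)
  hi (x ∷ a) (suc i) = hi a i

  -- For `u` the suffix after the chosen letter `x`, this spells the conjugate of `s x` by `u`, with
  -- `unwind u` as the inverse of `⟦ u ⟧`. Keeping the reflection as a word lets `affine` turn it
  -- into a group element.
  crossing : (a : Word n) → Fin (length a) → Word n
  crossing (x ∷ a) zero    = a ʳ++ (x ∷ a)
  crossing (x ∷ a) (suc i) = crossing a i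

  ⟦ʳ++⟧ : ∀ (a b : Word n) m → ⟦ a ʳ++ b ⟧ m ≡ unwind a (⟦ b ⟧ m)
  ⟦ʳ++⟧ []      b m = refl
  ⟦ʳ++⟧ (x ∷ a) b m = ⟦ʳ++⟧ a (x ∷ b) m

  -- Here `n ≥ 2` enters: otherwise `n` would have to divide 1.
  successor-distinct : ∀ x → ¬ (x ≋ (x + 1ℤ))
  successor-distinct x e with ≋-sym e
  ... | by k e′ = ℕ.<⇒≱ 2≤n (ℕ.∣⇒≤ (∣⇒∣ᵤ (divides k (∙-cancelˡ x 1ℤ (k * N) e′))))

  s-swaps : (x : Fin n) → Swaps (s x) (+ toℕ x) (+ toℕ x + 1ℤ)
  s-swaps x = record { distinct = successor-distinct (+ toℕ x) ; view = view′ }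
    where
    view′ : ∀ m → SwapView (+ toℕ x) (+ toℕ x + 1ℤ) m (s x m)
    view′ m with N ∣? (m - + toℕ x) | N ∣? (m - (+ toℕ x + 1ℤ))
    ... | yes m≡x | _ = let by k e = mod⇒≋ m≡x in
      left k e (trans (cong (_+ 1ℤ) e) (lemma (+ toℕ x) (k * N)))
      where
      lemma : ∀ x y → x + y + 1ℤ ≡ x + 1ℤ + y
      lemma = solve-∀
    ... | no _ | yes m≡x+1 = let by k e = mod⇒≋ m≡x+1 in
      right k e (trans (cong (_- 1ℤ) e) (lemma (+ toℕ x) (k * N)))
      where
      lemma : ∀ x y → x + 1ℤ + y - 1ℤ ≡ x + y
      lemma = solve-∀
    ... | no m≢x | no m≢x+1 = fixed (m≢x ∘ ≋⇒mod) (m≢x+1 ∘ ≋⇒mod) refl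

  s-involutive : ∀ (x : Fin n) m → s x (s x m) ≡ m
  s-involutive x = swaps-involutive (s-swaps x)

  s-injective : ∀ (x : Fin n) {m m′} → s x m ≡ s x m′ → m ≡ m′
  s-injective x {m} {m′} e =
    trans (sym (s-involutive x m)) (trans (cong (s x) e) (s-involutive x m′))

  ⟦⟧-equivariant : (a : Word n) → Equivariant ⟦ a ⟧
  ⟦⟧-equivariant []      m k = refl
  ⟦⟧-equivariant (x ∷ a) m k =
    trans (cong (s x) (⟦⟧-equivariant a m k)) (swaps-equivariant (s-swaps x) _ k)

  unwind-equivariant : (a : Word n) → Equivariant (unwind a)
  unwind-equivariant []      m k = refl
  unwind-equivariant (x ∷ a) m k =
    trans (cong (unwind a) (swaps-equivariant (s-swaps x) m k)) (unwind-equivariant a _ k)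

  unwind-⟦⟧ : ∀ (a : Word n) m → unwind a (⟦ a ⟧ m) ≡ m
  unwind-⟦⟧ []      m = refl
  unwind-⟦⟧ (x ∷ a) m = trans (cong (unwind a) (s-involutive x (⟦ a ⟧ m))) (unwind-⟦⟧ a m)

  ⟦⟧-unwind : ∀ (a : Word n) m → ⟦ a ⟧ (unwind a m) ≡ m
  ⟦⟧-unwind []      m = refl
  ⟦⟧-unwind (x ∷ a) m = trans (cong (s x) (⟦⟧-unwind a (s x m))) (s-involutive x m)

  ⟦⟧-injective : ∀ (a : Word n) {m m′} → ⟦ a ⟧ m ≡ ⟦ a ⟧ m′ → m ≡ m′
  ⟦⟧-injective a {m} {m′} e =
    trans (sym (unwind-⟦⟧ a m)) (trans (cong (unwind a) e) (unwind-⟦⟧ a m′))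

  crossing-swaps : ∀ a (i : Fin (length a)) → Swaps ⟦ crossing a i ⟧ (lo a i) (hi a i)
  crossing-swaps (x ∷ a) zero    = swaps-cong (λ m → sym (⟦ʳ++⟧ a (x ∷ a) m))
    (swaps-conjugate ⟦ a ⟧ (unwind a) (s-swaps x) (⟦⟧-equivariant a) (unwind-equivariant a)
                     (⟦⟧-unwind a) (unwind-⟦⟧ a))
  crossing-swaps (x ∷ a) (suc i) = crossing-swaps a i

  removeAt-crossing : ∀ a (i : Fin (length a)) m →
                      ⟦ removeAt a i ⟧ (⟦ crossing a i ⟧ m) ≡ ⟦ a ⟧ m
  removeAt-crossing (x ∷ a) zero    m =
    trans (cong ⟦ a ⟧ (⟦ʳ++⟧ a (x ∷ a) m)) (⟦⟧-unwind a (s x (⟦ a ⟧ m)))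
  removeAt-crossing (x ∷ a) (suc i) m = cong (s x) (removeAt-crossing a i m)

  removeAt-swaps : ∀ {t p q} a (i : Fin (length a)) → Swaps t p q →
                   Shifted p q (lo a i) (hi a i) → ∀ m → ⟦ removeAt a i ⟧ m ≡ ⟦ a ⟧ (t m)
  removeAt-swaps {t} a i f σ m = begin
    ⟦ removeAt a i ⟧ m                         ≡⟨ cong ⟦ removeAt a i ⟧ (swaps-involutive f m) ⟨
    ⟦ removeAt a i ⟧ (t (t m))                 ≡⟨ cong ⟦ removeAt a i ⟧ (swaps-unique (swaps-shift σ f) (crossing-swaps a i) (t m)) ⟩
    ⟦ removeAt a i ⟧ (⟦ crossing a i ⟧ (t m))  ≡⟨ removeAt-crossing a i (t m) ⟩
    ⟦ a ⟧ (t m)                                ∎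
    where open ≡-Reasoning

  -- Inversions and the strong exchange property.

  no-between : ∀ {i j} → i < j → ¬ j < i + 1ℤ
  no-between {i} {j} i<j j<i+1 =
    ℤ.<-irrefl refl (ℤ.<-≤-trans j<i+1 (subst (ℤ._≤ j) (ℤ.+-comm 1ℤ i) (ℤ.i<j⇒suc[i]≤j i<j)))

  <+1 : ∀ i → i < i + 1ℤ
  <+1 i = ℤ.suc[i]≤j⇒i<j (ℤ.≤-reflexive (ℤ.+-comm 1ℤ i))

  s-raises : ∀ (x : Fin n) m → (∃ λ k → m ≡ + toℕ x + k * N × s x m ≡ m + 1ℤ) ⊎ s x m ℤ.≤ m
  s-raises x m with s x m | view (s-swaps x) m
  ... | _ | left k refl refl  = inj₁ (k , refl , lemma (+ toℕ x) (k * N))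
    where
    lemma : ∀ x y → x + 1ℤ + y ≡ x + y + 1ℤ
    lemma = solve-∀
  ... | _ | right k refl refl = inj₂ (ℤ.<⇒≤ (ℤ.+-monoˡ-< (k * N) (<+1 (+ toℕ x))))
  ... | _ | fixed _ _ refl    = inj₂ ℤ.≤-refl

  s-lowers : ∀ (x : Fin n) m → m ≡ s x m + 1ℤ ⊎ m ℤ.≤ s x m
  s-lowers x m with s-raises x (s x m) | s-involutive x m
  ... | inj₁ (_ , _ , e) | e′ = inj₁ (trans (sym e′) e)
  ... | inj₂ le          | e′ = inj₂ (subst (ℤ._≤ s x m) e′ le)

  -- A simple reflection moves a point by at most one, so an inversion needs `p` to rise by one and
  -- `q` to drop by one. If `s x q` differed from `p`, an integer would lie strictly between two
  -- consecutive ones; hence `q` is `p + 1`.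
  s-inverts : ∀ x {p q} → p < q → s x q < s x p → Shifted (+ toℕ x) (+ toℕ x + 1ℤ) p q
  s-inverts x {p} {q} p<q sq<sp with s-raises x p | s-lowers x q
  ... | inj₂ sp≤p | inj₁ q≡sq+1 =
    contradiction (subst (p <_) q≡sq+1 p<q) (no-between (ℤ.<-≤-trans sq<sp sp≤p))
  ... | inj₂ sp≤p | inj₂ q≤sq =
    contradiction (ℤ.<-trans p<q (ℤ.≤-<-trans q≤sq (ℤ.<-≤-trans sq<sp sp≤p))) (ℤ.<-irrefl refl)
  ... | inj₁ (k , _ , sp≡p+1) | inj₂ q≤sq =
    contradiction (subst (q <_) sp≡p+1 (ℤ.≤-<-trans q≤sq sq<sp)) (no-between p<q)
  ... | inj₁ (k , e , sp≡p+1) | inj₁ q≡sq+1 with ℤ.<-cmp p (s x q)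
  ...   | tri< p<sq _ _ = contradiction (subst (s x q <_) sp≡p+1 sq<sp) (no-between p<sq)
  ...   | tri> _ _ sq<p = contradiction (subst (p <_) q≡sq+1 p<q) (no-between sq<p)
  ...   | tri≈ _ p≡sq _ = by k e (begin
    q                        ≡⟨ q≡sq+1 ⟩
    s x q + 1ℤ               ≡⟨ cong (_+ 1ℤ) p≡sq ⟨
    p + 1ℤ                   ≡⟨ cong (_+ 1ℤ) e ⟩
    + toℕ x + k * N + 1ℤ     ≡⟨ lemma (+ toℕ x) (k * N) ⟩
    + toℕ x + 1ℤ + k * N     ∎)
    where
    open ≡-Reasoning
    lemma : ∀ x y → x + y + 1ℤ ≡ x + 1ℤ + y
    lemma = solve-∀

  -- Going from the left, take the first letter whose remaining suffix no longer inverts `p` and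
  -- `q`. This letter reverses their order, so by `s-inverts` it crosses exactly these two wires.
  inversion-crosses : ∀ a {p q} → p < q → ⟦ a ⟧ q < ⟦ a ⟧ p →
                      ∃ λ i → Shifted p q (lo a i) (hi a i)
  inversion-crosses []      p<q q<p = contradiction q<p (ℤ.<-asym p<q)
  inversion-crosses (x ∷ a) {p} {q} p<q inv with ℤ.<-cmp (⟦ a ⟧ p) (⟦ a ⟧ q)
  ... | tri> _ _ aq<ap = let i , σ = inversion-crosses a p<q aq<ap in suc i , σ
  ... | tri≈ _ e _     = contradiction p<q (ℤ.<-irrefl (⟦⟧-injective a e))
  ... | tri< ap<aq _ _ = zero , by k (pull p e) (pull q e′)
    where
    open Shifted (shifted-sym (s-inverts x ap<aq inv)) renaming (turns to k; shiftˡ to e; shiftʳ to e′)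
    pull : ∀ m {y} → y ≡ ⟦ a ⟧ m + k * N → unwind a y ≡ m + k * N
    pull m e = trans (cong (unwind a) e) (trans (unwind-equivariant a _ k) (cong (_+ k * N) (unwind-⟦⟧ a m)))

  exchange : ∀ {t p q} a → Swaps t p q → p < q → ⟦ a ⟧ q < ⟦ a ⟧ p →
             ∃ λ i → Shifted p q (lo a i) (hi a i) × ∀ m → ⟦ removeAt a i ⟧ m ≡ ⟦ a ⟧ (t m)
  exchange a t p<q inv =
    let i , σ = inversion-crosses a p<q inv in i , σ , removeAt-swaps a i t σ

  -- Since `t` interchanges `p` and `q`, one of `a` and `c` inverts the pair, and `exchange` deletes
  -- a letter from that one.
  strong-exchange : ∀ {t p q} a c → Swaps t p q → p < q → (∀ m → ⟦ a ⟧ m ≡ ⟦ c ⟧ (t m)) →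
                    (∃ λ i → Shifted p q (lo a i) (hi a i) × ⟦ removeAt a i ⟧ ≗ ⟦ c ⟧) ⊎
                    (∃ λ j → ⟦ removeAt c j ⟧ ≗ ⟦ a ⟧)
  strong-exchange {t} {p} {q} a c f p<q e with ℤ.<-cmp (⟦ a ⟧ p) (⟦ a ⟧ q)
  ... | tri> _ _ aq<ap =
    let i , σ , e′ = exchange a f p<q aq<ap
    in inj₁ (i , σ , λ m → trans (e′ m) (trans (e (t m)) (cong ⟦ c ⟧ (swaps-involutive f m))))
  ... | tri≈ _ e _     = contradiction p<q (ℤ.<-irrefl (⟦⟧-injective a e))
  ... | tri< ap<aq _ _ =
    let j , _ , e′ = exchange c f p<q (subst₂ _<_ (trans (e p) (cong ⟦ c ⟧ (swaps-left f)))
                                                  (trans (e q) (cong ⟦ c ⟧ (swaps-right f))) ap<aq)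
    in inj₂ (j , λ m → trans (e′ m) (sym (e m)))

  -- Reduced words are those with positive crossings.

  Positive : Word n → Set
  Positive a = ∀ i → lo a i < hi a i

  length-removeAt< : ∀ (a : Word n) i → length (removeAt a i) ℕ.< length a
  length-removeAt< a i = ℕ.≤-reflexive (sym (length-removeAt′ a i))

  -- A competitor `b` also inverts the wires of the head letter, so deleting one letter of `b` gives
  -- a word for the tail, and induction bounds its length.
  positive⇒reduced : ∀ a → Positive a → Reduced a
  positive⇒reduced []      pos b e = z≤n
  positive⇒reduced (x ∷ a) pos b e =
    let j , _ , e′ = exchange b (crossing-swaps (x ∷ a) zero) (pos zero) inverted
    in ℕ.≤-<-trans (positive⇒reduced a (pos ∘ suc) (removeAt b j)
                     λ m → trans (e′ m) (trans (e _) (trans (sym (removeAt-crossing (x ∷ a) zero _))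
                       (cong ⟦ a ⟧ (swaps-involutive (crossing-swaps (x ∷ a) zero) m)))))
                   (length-removeAt< b j)
    where
    inverted : ⟦ b ⟧ (hi (x ∷ a) zero) < ⟦ b ⟧ (lo (x ∷ a) zero)
    inverted = subst₂ _<_
      (sym (trans (e _) (trans (cong (s x) (⟦⟧-unwind a _)) (swaps-right (s-swaps x)))))
      (sym (trans (e _) (trans (cong (s x) (⟦⟧-unwind a _)) (swaps-left (s-swaps x)))))
      (<+1 (+ toℕ x))

  crossing-distinct : ∀ a i → ¬ lo a i ≡ hi a i
  crossing-distinct a i e =
    distinct (crossing-swaps a i) (by 0ℤ (trans e (sym (ℤ.+-identityʳ (hi a i)))))

  Shorter : Word n → Set
  Shorter a = ∃ λ (c : Word n) → ⟦ c ⟧ ≗ ⟦ a ⟧ × length c ℕ.< length a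

  -- A head letter with `hi` below `lo` crosses two wires that the tail has already inverted;
  -- dropping it and the tail letter found by `exchange` leaves the element unchanged. The
  -- disjunction also makes `Reduced`, a statement about all words, decidable.
  positive⊎shorter : ∀ a → Positive a ⊎ Shorter a
  positive⊎shorter []      = inj₁ λ ()
  positive⊎shorter (x ∷ a) with positive⊎shorter a
  ... | inj₂ (c , e , c<a) = inj₂ (x ∷ c , (λ m → cong (s x) (e m)) , s≤s c<a)
  ... | inj₁ pos with ℤ.<-cmp (lo (x ∷ a) zero) (hi (x ∷ a) zero)
  ...   | tri< lo<hi _ _ = inj₁ λ { zero → lo<hi ; (suc i) → pos i }
  ...   | tri≈ _ e _     = contradiction e (crossing-distinct (x ∷ a) zero)
  ...   | tri> _ _ hi<lo =
    let j , _ , e = exchange a (swaps-sym (crossing-swaps (x ∷ a) zero)) hi<lo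
                      (subst₂ _<_ (sym (⟦⟧-unwind a _)) (sym (⟦⟧-unwind a _)) (<+1 (+ toℕ x)))
    in inj₂ (removeAt a j
            , (λ m → trans (e m) (removeAt-crossing (x ∷ a) zero m))
            , ℕ.<-trans (length-removeAt< a j) ℕ.≤-refl)

  reduced⇒positive : ∀ a → Reduced a → Positive a
  reduced⇒positive a red with positive⊎shorter a
  ... | inj₁ pos           = pos
  ... | inj₂ (c , e , c<a) = contradiction (red c e) (ℕ.<⇒≱ c<a)

  reduced⊎shorter : ∀ a → Reduced a ⊎ Shorter a
  reduced⊎shorter a with positive⊎shorter a
  ... | inj₁ pos     = inj₁ (positive⇒reduced a pos)
  ... | inj₂ shorter = inj₂ shorter

  reduced? : ∀ (a : Word n) → Dec (Reduced a)
  reduced? a with reduced⊎shorter a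
  ... | inj₁ red           = yes red
  ... | inj₂ (c , e , c<a) = no λ red → ℕ.<⇒≱ c<a (red c e)

  reduced-transfer : ∀ (a b : Word n) → ⟦ b ⟧ ≗ ⟦ a ⟧ → length a ≡ length b → Reduced a → Reduced b
  reduced-transfer a b e l red c c≗b =
    subst (_≤ length c) l (red c λ m → trans (c≗b m) (e m))

  reduced-tail : ∀ x (a : Word n) → Reduced (x ∷ a) → Reduced a
  reduced-tail x a red b e = ℕ.s≤s⁻¹ (red (x ∷ b) λ m → cong (s x) (e m))

  -- How many marks a word can carry.

  length-removeAt-≡ : ∀ (a : Word n) i j → length (removeAt a i) ≡ length (removeAt a j)
  length-removeAt-≡ a i j =
    ℕ.suc-injective (trans (sym (length-removeAt′ a i)) (length-removeAt′ a j))

  reduced-removeAt : ∀ (b : Word n) i j → ⟦ removeAt b i ⟧ ≗ ⟦ removeAt b j ⟧ →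
                     Reduced (removeAt b i) → Reduced (removeAt b j)
  reduced-removeAt b i j e = reduced-transfer (removeAt b i) (removeAt b j)
    (λ m → sym (e m)) (length-removeAt-≡ b i j)

  -- Strip letters until the first mark is the head. Both deletions give one element, so both
  -- reflections agree and the two pairs of wires coincide up to a shift and order. Equal order is
  -- excluded by positivity of two reduced words: the word without its head, and the word without
  -- its letter at `j`.
  opposite-< : ∀ b i j → toℕ i ℕ.< toℕ j → Reduced (removeAt b i) →
               ⟦ removeAt b i ⟧ ≗ ⟦ removeAt b j ⟧ →
               Shifted (lo b i) (hi b i) (hi b j) (lo b j)
  opposite-< (x ∷ b) (suc i) (suc j) (s≤s i<j) red e =
    opposite-< b i j i<j (reduced-tail x (removeAt b i) red) (λ m → s-injective x (e m))
  opposite-< (x ∷ b) zero    (suc j) _ red e with swaps-same t₀ (swaps-cong (sym ∘ t₀≗tⱼ) tⱼ)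
    where
    t₀ = crossing-swaps (x ∷ b) zero
    tⱼ = crossing-swaps b j
    t₀≗tⱼ : ⟦ crossing (x ∷ b) zero ⟧ ≗ ⟦ crossing b j ⟧
    t₀≗tⱼ m = ⟦⟧-injective b (begin
      ⟦ b ⟧ (⟦ crossing (x ∷ b) zero ⟧ m)                       ≡⟨ removeAt-crossing (x ∷ b) zero m ⟩
      s x (⟦ b ⟧ m)                                             ≡⟨ cong (s x) (e m) ⟩
      s x (s x (⟦ removeAt b j ⟧ m))                            ≡⟨ s-involutive x _ ⟩
      ⟦ removeAt b j ⟧ m                                        ≡⟨ cong ⟦ removeAt b j ⟧ (swaps-involutive tⱼ m) ⟨
      ⟦ removeAt b j ⟧ (⟦ crossing b j ⟧ (⟦ crossing b j ⟧ m))  ≡⟨ removeAt-crossing b j _ ⟩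
      ⟦ b ⟧ (⟦ crossing b j ⟧ m)                                ∎)
      where open ≡-Reasoning
  ... | inj₂ σ = shifted-swap σ
  ... | inj₁ σ = contradiction (shifted-< (shifted-sym σ) (reduced⇒positive b red j)) (ℤ.<-asym hi<lo)
    where
    t₀ = crossing-swaps (x ∷ b) zero
    tⱼ = swaps-shift (shifted-sym σ) (crossing-swaps b j)
    unwind-removeAt : ∀ m → unwind (removeAt b j) m ≡ ⟦ crossing b j ⟧ (unwind b m)
    unwind-removeAt m = begin
      unwind (removeAt b j) m                                                     ≡⟨ cong (unwind (removeAt b j)) (⟦⟧-unwind b m) ⟨
      unwind (removeAt b j) (⟦ b ⟧ (unwind b m))                                  ≡⟨ cong (unwind (removeAt b j)) (removeAt-crossing b j _) ⟨
      unwind (removeAt b j) (⟦ removeAt b j ⟧ (⟦ crossing b j ⟧ (unwind b m)))    ≡⟨ unwind-⟦⟧ (removeAt b j) _ ⟩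
      ⟦ crossing b j ⟧ (unwind b m)                                               ∎
      where open ≡-Reasoning
    -- Deleting the letter at `j` interchanges the two wires as met by the head, and the resulting
    -- word is reduced because it has the element and length of `b`.
    hi<lo : hi (x ∷ b) zero < lo (x ∷ b) zero
    hi<lo = subst₂ _<_
      (trans (unwind-removeAt _) (swaps-left tⱼ)) (trans (unwind-removeAt _) (swaps-right tⱼ))
      (reduced⇒positive (x ∷ removeAt b j)
        (reduced-transfer b (x ∷ removeAt b j) (λ m → sym (e m)) (length-removeAt′ b j) red) zero)

  opposite : ∀ b i j → toℕ i ≢ toℕ j → Reduced (removeAt b i) →
             ⟦ removeAt b i ⟧ ≗ ⟦ removeAt b j ⟧ →
             Shifted (lo b i) (hi b i) (hi b j) (lo b j)
  opposite b i j i≢j red e with ℕ.<-cmp (toℕ i) (toℕ j)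
  ... | tri< i<j _ _ = opposite-< b i j i<j red e
  ... | tri≈ _ i≡j _ = contradiction i≡j i≢j
  ... | tri> _ _ j<i = shifted-swap (shifted-sym (opposite-< b j i j<i
    (reduced-removeAt b i j e red) (λ m → sym (e m))))

  -- Two distinct marks would have opposite orders, but in a reduced word both are positive.
  mark-unique : ∀ b i j → Reduced b → Reduced (removeAt b i) →
                ⟦ removeAt b i ⟧ ≗ ⟦ removeAt b j ⟧ → toℕ i ≡ toℕ j
  mark-unique b i j red redᵢ e with toℕ i ℕ.≟ toℕ j
  ... | yes i≡j = i≡j
  ... | no i≢j  = contradiction (shifted-< (opposite b i j i≢j redᵢ e) (pos i)) (ℤ.<-asym (pos j))
    where pos = reduced⇒positive b red

  -- Two marks both opposite to `i` have the same order, yet would also be opposite to each other;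
  -- then `lo` and `hi` at `j` would be congruent.
  third-mark : ∀ b i j k → toℕ i ≢ toℕ j → toℕ i ≢ toℕ k → Reduced (removeAt b i) →
               ⟦ removeAt b i ⟧ ≗ ⟦ removeAt b j ⟧ → ⟦ removeAt b i ⟧ ≗ ⟦ removeAt b k ⟧ →
               toℕ j ≡ toℕ k
  third-mark b i j k i≢j i≢k red eⱼ eₖ with toℕ j ℕ.≟ toℕ k
  ... | yes j≡k = j≡k
  ... | no j≢k  = contradiction loⱼ≋hiⱼ (distinct (crossing-swaps b j))
    where
    σ : Shifted (hi b j) (lo b j) (hi b k) (lo b k)
    σ = shifted-trans (shifted-sym (opposite b i j i≢j red eⱼ)) (opposite b i k i≢k red eₖ)
    τ : Shifted (lo b j) (hi b j) (hi b k) (lo b k)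
    τ = opposite b j k j≢k (reduced-removeAt b i j eⱼ red)
                 (λ m → trans (sym (eⱼ m)) (eₖ m))
    loⱼ≋hiⱼ : lo b j ≋ hi b j
    loⱼ≋hiⱼ = ≋-sym (shifted⇒≋ (shifted-trans τ (shifted-sym σ)))

  double-deletion : ∀ (b : Word n) i j → ⟦ removeAt (removeAt b i) j ⟧ ≗ ⟦ b ⟧ →
                    ∃ λ k → toℕ k ≢ toℕ i × ⟦ removeAt b k ⟧ ≗ ⟦ removeAt b i ⟧
  double-deletion (x ∷ b) zero j e =
    suc j , (λ ()) , λ m → trans (cong (s x) (e m)) (s-involutive x (⟦ b ⟧ m))
  double-deletion (x ∷ b) (suc i) zero e =
    zero , (λ ()) , λ m → trans (sym (s-involutive x (⟦ b ⟧ m))) (cong (s x) (sym (e m)))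
  double-deletion (x ∷ b) (suc i) (suc j) e =
    let k , k≢i , e′ = double-deletion b i j (λ m → s-injective x (e m))
    in suc k , k≢i ∘ ℕ.suc-injective , λ m → cong (s x) (e′ m)

  -- A shorter word `c` for `b` differs from `removeAt b i` by the reflection at `i`. Exchange
  -- cannot delete from `c`, which would undercut a reduced word, so it deletes a second letter from
  -- `removeAt b i` and recovers the element of `b`.
  second-mark : ∀ b i → ¬ Reduced b → Reduced (removeAt b i) →
                ∃ λ j → toℕ j ≢ toℕ i × ⟦ removeAt b j ⟧ ≗ ⟦ removeAt b i ⟧
  second-mark b i ¬red red with reduced⊎shorter b
  ... | inj₁ redᵇ          = contradiction redᵇ ¬red
  ... | inj₂ (c , e , c<b) with ordered
    where
    -- As `b` is not reduced, the order of the wires at `i` is unknown; the pair is sorted to suit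
    -- `strong-exchange`.
    ordered : ∃₂ λ p q → p < q × Swaps ⟦ crossing b i ⟧ p q
    ordered with ℤ.<-cmp (lo b i) (hi b i)
    ... | tri< lo<hi _ _ = _ , _ , lo<hi , crossing-swaps b i
    ... | tri≈ _ lo≡hi _ = contradiction lo≡hi (crossing-distinct b i)
    ... | tri> _ _ hi<lo = _ , _ , hi<lo , swaps-sym (crossing-swaps b i)
  ... | p , q , p<q , t with strong-exchange c (removeAt b i) t p<q
                               (λ m → trans (e m) (sym (removeAt-crossing b i m)))
  ...   | inj₂ (j , e′) = double-deletion b i j (λ m → trans (e′ m) (e m))
  ...   | inj₁ (j , _ , e′) = contradiction (red (removeAt c j) e′) (ℕ.<⇒≱
    (ℕ.<-≤-trans (length-removeAt< c j) (ℕ.s≤s⁻¹ (subst (length c ℕ.<_) (length-removeAt′ b i) c<b))))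

  -- Every word represents an element of the affine symmetric group.

  window : (ℤ → ℤ) → ℤ → ℤ
  window f c = sum {n} (λ k → f (c + + toℕ k))

  -- After adding `f c`, both sides are the sum of `f` over `n + 1` consecutive integers, split off
  -- at the first or at the last term.
  window-suc : ∀ f → Equivariant f → ∀ c → window f (1ℤ + c) ≡ window f c + N
  window-suc f eq c = ∙-cancelˡ (f c) _ _ (begin
    f c + window f (1ℤ + c)                ≡⟨ cong₂ _+_ (cong f (sym (ℤ.+-identityʳ c))) (sum-cong-≗ {n} λ k → cong f (lemma c (+ toℕ k))) ⟩
    sum {ℕ.suc n} (λ k → f (c + + toℕ k))  ≡⟨ sum-init-last {n} (λ k → f (c + + toℕ k)) ⟩
    sum {n} (λ k → f (c + + toℕ (inject₁ k))) + f (c + + toℕ (fromℕ n))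
                                           ≡⟨ cong₂ _+_ (sum-cong-≗ {n} λ k → cong (λ j → f (c + + j)) (Fin.toℕ-inject₁ k))
                                                        (trans (cong (λ j → f (c + j)) last) (eq c 1ℤ)) ⟩
    window f c + (f c + 1ℤ * N)            ≡⟨ lemma′ (window f c) (f c) N ⟩
    f c + (window f c + N)                 ∎)
    where
    open ≡-Reasoning
    lemma : ∀ c k → 1ℤ + c + k ≡ c + (1ℤ + k)
    lemma = solve-∀
    lemma′ : ∀ w x N → w + (x + 1ℤ * N) ≡ x + (w + N)
    lemma′ = solve-∀
    last : + toℕ (fromℕ n) ≡ 1ℤ * N
    last = trans (cong +_ (Fin.toℕ-fromℕ n)) (sym (ℤ.*-identityˡ N))

  -- Moving the window changes both sums by the same amount, so they may be compared at any
  -- convenient start.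
  window-agree : ∀ f g → Equivariant f → Equivariant g →
                 ∀ c → window f (+ c) ≡ window g (+ c) → window f 0ℤ ≡ window g 0ℤ
  window-agree f g f-eq g-eq ℕ.zero    e = e
  window-agree f g f-eq g-eq (ℕ.suc c) e = window-agree f g f-eq g-eq c
    (∙-cancelʳ N _ _ (trans (sym (window-suc f f-eq (+ c))) (trans e (window-suc g g-eq (+ c)))))

  offset-distinct : ∀ x {j k} → j ℕ.< k → k ℕ.< n → ¬ (x + + k) ≋ (x + + j)
  offset-distinct x {j} {k} j<k k<n (by t e) with ℕ.m≤n⇒∃[o]m+o≡n j<k
  ... | d , refl = ℕ.<⇒≱ (ℕ.≤-<-trans (s≤s (ℕ.m≤n+m d j)) k<n)
    (ℕ.∣⇒≤ (∣⇒∣ᵤ (divides t (∙-cancelˡ (x + + j) (+ ℕ.suc d) (t * N) (trans (lemma x (+ j) (+ d)) e)))))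
    where
    lemma : ∀ x j d → x + j + (1ℤ + d) ≡ x + (1ℤ + (j + d))
    lemma = solve-∀

  -- The comparison is made on the window starting at `x`, where `s x` just interchanges the first
  -- two entries. On the window starting at 1 the reflection `s zero` would cross the boundary.
  window-s : ∀ f → Equivariant f → ∀ x → window (f ∘ s x) 1ℤ ≡ window f 1ℤ
  window-s f eq x = begin
    window (f ∘ s x) 1ℤ       ≡⟨ window-suc (f ∘ s x) eqs 0ℤ ⟩
    window (f ∘ s x) 0ℤ + N   ≡⟨ cong (_+ N) (window-agree (f ∘ s x) f eqs eq (toℕ x) at-x) ⟩
    window f 0ℤ + N           ≡⟨ window-suc f eq 0ℤ ⟨
    window f 1ℤ               ∎
    where
    open ≡-Reasoning
    eqs : Equivariant (f ∘ s x)
    eqs m k = trans (cong f (swaps-equivariant (s-swaps x) m k)) (eq (s x m) k)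
    x₀ = + toℕ x
    +0 : x₀ ≡ x₀ + 0ℤ
    +0 = sym (ℤ.+-identityʳ x₀)
    fixes : ∀ k → 2 ≤ k → k ℕ.< n → s x (x₀ + + k) ≡ x₀ + + k
    fixes k 2≤k k<n = view-unique (successor-distinct x₀) (view (s-swaps x) (x₀ + + k))
      (fixed (offset-distinct x₀ (ℕ.<-trans (s≤s z≤n) 2≤k) k<n ∘ subst (x₀ + + k ≋_) +0)
             (offset-distinct x₀ 2≤k k<n) refl)
    at-x : window (f ∘ s x) x₀ ≡ window f x₀
    at-x = sum-swap 2≤n (λ k → f (s x (x₀ + + k))) (λ k → f (x₀ + + k))
      (cong f (trans (cong (s x) (sym +0)) (swaps-left (s-swaps x))))
      (cong f (trans (swaps-right (s-swaps x)) +0))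
      (λ k 2≤k k<n → cong f (fixes k 2≤k k<n))

  window-⟦⟧ : ∀ a f → Equivariant f → window (f ∘ ⟦ a ⟧) 1ℤ ≡ window f 1ℤ
  window-⟦⟧ []      f eq = refl
  window-⟦⟧ (x ∷ a) f eq = trans
    (window-⟦⟧ a (f ∘ s x) λ m k → trans (cong f (swaps-equivariant (s-swaps x) m k)) (eq (s x m) k))
    (window-s f eq x)

  affine : Word n → Affine n
  affine a = record
    { fun       = ⟦ a ⟧
    ; bijective = ⟦⟧-injective a
                , λ m → unwind a m , λ e → trans (cong ⟦ a ⟧ e) (⟦⟧-unwind a m)
    ; periodic  = λ i → subst (λ N → ⟦ a ⟧ (i + N) ≡ ⟦ a ⟧ i + N) (ℤ.*-identityˡ N)
                              (⟦⟧-equivariant a i 1ℤ)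
    ; balanced  = window-⟦⟧ a id (λ _ _ → refl)
    }

  -- The effect of lowering a letter on its wires.

  lowered : (a : Word n) (i : Fin (length a)) → Fin (length (a [ i ]%= lower))
  lowered (x ∷ a) zero    = zero
  lowered (x ∷ a) (suc i) = suc (lowered a i)

  toℕ-lowered : ∀ a i → toℕ (lowered a i) ≡ toℕ i
  toℕ-lowered (x ∷ a) zero    = refl
  toℕ-lowered (x ∷ a) (suc i) = cong ℕ.suc (toℕ-lowered a i)

  removeAt-lowered : ∀ a i → removeAt (a [ i ]%= lower) (lowered a i) ≡ removeAt a i
  removeAt-lowered (x ∷ a) zero    = refl
  removeAt-lowered (x ∷ a) (suc i) = cong (x ∷_) (removeAt-lowered a i)

  hi-lower : ∀ (x : Fin n) → (+ toℕ (lower x) + 1ℤ) ≋ + toℕ x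
  hi-lower zero    = by 1ℤ (begin
    + toℕ (fromℕ (ℕ.pred n)) + 1ℤ  ≡⟨ cong (λ k → + k + 1ℤ) (Fin.toℕ-fromℕ _) ⟩
    + ℕ.pred n + 1ℤ                ≡⟨ ℤ.+-comm (+ ℕ.pred n) 1ℤ ⟩
    N                              ≡⟨ ℤ.*-identityˡ N ⟨
    1ℤ * N                         ≡⟨ ℤ.+-identityˡ (1ℤ * N) ⟨
    0ℤ + 1ℤ * N                    ∎)
    where open ≡-Reasoning
  hi-lower (suc x) = by 0ℤ (begin
    + toℕ (inject₁ x) + 1ℤ  ≡⟨ cong (λ k → + k + 1ℤ) (Fin.toℕ-inject₁ x) ⟩
    + toℕ x + 1ℤ            ≡⟨ ℤ.+-comm (+ toℕ x) 1ℤ ⟩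
    + toℕ (suc x)           ≡⟨ ℤ.+-identityʳ (+ toℕ (suc x)) ⟨
    + toℕ (suc x) + 0ℤ      ∎)
    where open ≡-Reasoning

  -- The suffix after the letter is untouched, and the lowered letter has the old lower position as
  -- its upper one. Wrapping from 0 to `n - 1` costs one full turn, hence only a congruence.
  hi-lowered : ∀ a i → hi (a [ i ]%= lower) (lowered a i) ≋ lo a i
  hi-lowered (x ∷ a) zero    =
    let by k e = hi-lower x in by k (trans (cong (unwind a) e) (unwind-equivariant a _ k))
  hi-lowered (x ∷ a) (suc i) = hi-lowered a i

  -- Edges of the affine Little graph.

  module _ (v : Affine n) where

    M : Set
    M = MarkedWord v

    loₘ hiₘ : M → ℤ
    loₘ x = lo (word x) (idx x)
    hiₘ x = hi (word x) (idx x)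

    ≈ₘ-refl : ∀ (x : M) → x ≈ₘ x
    ≈ₘ-refl _ = refl , refl

    ≈ₘ-sym : ∀ (x y : M) → x ≈ₘ y → y ≈ₘ x
    ≈ₘ-sym _ _ (e , e′) = sym e , sym e′

    ≈ₘ-trans : ∀ (x y z : M) → x ≈ₘ y → y ≈ₘ z → x ≈ₘ z
    ≈ₘ-trans _ _ _ (e , e′) (f , f′) = trans e f , trans e′ f′

    ⟶-respˡ : ∀ {x x′ y : M} → x ≈ₘ x′ → x ⟶ y → x′ ⟶ y
    ⟶-respˡ {mkMarked a i _} {mkMarked a i′ _} (refl , i≡i′) e with Fin.toℕ-injective i≡i′
    ... | refl = record { bumps = bumps e ; stays = stays e ; moves = moves e }

    ⟶-respʳ : ∀ {x y y′ : M} → y ≈ₘ y′ → x ⟶ y → x ⟶ y′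
    ⟶-respʳ {y = mkMarked a i _} {mkMarked a i′ _} (refl , i≡i′) e with Fin.toℕ-injective i≡i′
    ... | refl = record { bumps = bumps e ; stays = stays e ; moves = moves e }

    marks-agree : ∀ b i j → removeAt b i ∈R v → removeAt b j ∈R v →
                  ⟦ removeAt b i ⟧ ≗ ⟦ removeAt b j ⟧
    marks-agree b i j (e , _) (e′ , _) m = trans (e m) (sym (e′ m))

    mark : ∀ b i j → ⟦ removeAt b j ⟧ ≗ ⟦ removeAt b i ⟧ → removeAt b i ∈R v → removeAt b j ∈R v
    mark b i j e (e′ , red) =
      (λ m → trans (e m) (e′ m)) , reduced-removeAt b i j (λ m → sym (e m)) red

    reduced-marks : ∀ b i j → Reduced b → removeAt b i ∈R v → removeAt b j ∈R v → toℕ i ≡ toℕ j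
    reduced-marks b i j red mᵢ mⱼ = mark-unique b i j red (proj₂ mᵢ) (marks-agree b i j mᵢ mⱼ)

    other-marks : ∀ b i j k → toℕ j ≢ toℕ i → toℕ k ≢ toℕ i → removeAt b i ∈R v →
                  removeAt b j ∈R v → removeAt b k ∈R v → toℕ j ≡ toℕ k
    other-marks b i j k j≢i k≢i mᵢ mⱼ mₖ =
      third-mark b i j k (≢-sym j≢i) (≢-sym k≢i) (proj₂ mᵢ)
        (marks-agree b i j mᵢ mⱼ) (marks-agree b i k mᵢ mₖ)

    -- This is why elements of `R` may be compared as words only: reducedness determines the mark.
    reduced-≈ₘ : ∀ (x y : M) → Reduced (word x) → word x ≡ word y → x ≈ₘ y
    reduced-≈ₘ (mkMarked a i mᵢ) (mkMarked a j mⱼ) red refl = refl , reduced-marks a i j red mᵢ mⱼ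

    -- The position of the lowered letter is a mark of the new word, whether or
    -- not it stays the distinguished one.
    oldMark : ∀ {x y : M} → x ⟶ y →
              ∃ λ k → toℕ k ≡ toℕ (idx x) × removeAt (word y) k ∈R v × hi (word y) k ≋ loₘ x
    oldMark {mkMarked a i m} {mkMarked _ j _} record { bumps = refl } =
      lowered a i , toℕ-lowered a i , subst (_∈R v) (sym (removeAt-lowered a i)) m , hi-lowered a i

    ⟶-deterministic : ∀ {x y z : M} → x ⟶ y → x ⟶ z → y ≈ₘ z
    ⟶-deterministic {y = mkMarked b j mⱼ} {mkMarked b′ j′ mⱼ′} e e′
      with trans (bumps e) (sym (bumps e′))
    ... | refl with oldMark e | reduced? b
    ...   | _                | yes red = refl , trans (stays e red) (sym (stays e′ red))
    ...   | k , k≡i , mₖ , _ | no ¬red = refl , other-marks b k j j′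
      (λ j≡k → moves e ¬red (trans j≡k k≡i)) (λ j′≡k → moves e′ ¬red (trans j′≡k k≡i)) mₖ mⱼ mⱼ′

    -- The target reveals the lowered position: it is the mark itself if the word is reduced, and
    -- the only other mark if not. Raising that letter again recovers the source.
    ⟶-injective : ∀ {x x′ y : M} → x ⟶ y → x′ ⟶ y → x ≈ₘ x′
    ⟶-injective {x} {x′} {y} e e′ =
      updateAt-injective lower-injective (word x) (word x′) (idx x) (idx x′) i≡i′
        (trans (sym (bumps e)) (bumps e′)) , i≡i′
      where
      i≡i′ : toℕ (idx x) ≡ toℕ (idx x′)
      i≡i′ with reduced? (word y)
      ... | yes red = trans (sym (stays e red)) (stays e′ red)
      ... | no ¬red =
        let k  , k≡i   , mₖ  , _ = oldMark e
            k′ , k′≡i′ , mₖ′ , _ = oldMark e′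
        in trans (sym k≡i) (trans (other-marks (word y) (idx y) k k′
             (λ k≡j → moves e ¬red (trans (sym k≡j) k≡i))
             (λ k′≡j → moves e′ ¬red (trans (sym k′≡j) k′≡i′)) (marked y) mₖ mₖ′) k′≡i′)

    stay-hi : ∀ {x y : M} → x ⟶ y → Reduced (word y) → hiₘ y ≋ loₘ x
    stay-hi {x} {y} e red with oldMark e
    ... | k , k≡i , _ , hi≋lo = subst (λ j → hi (word y) j ≋ loₘ x)
      (Fin.toℕ-injective (trans k≡i (sym (stays e red)))) hi≋lo

    move-lo : ∀ {x y : M} → x ⟶ y → ¬ Reduced (word y) → loₘ y ≋ loₘ x
    move-lo {x} {y} e ¬red with oldMark e
    ... | k , k≡i , mₖ , hi≋lo = ≋-trans (shifted⇒≋ (shifted-swap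
      (opposite (word y) k (idx y) (λ k≡j → moves e ¬red (trans (sym k≡j) k≡i)) (proj₂ mₖ)
                (marks-agree (word y) k (idx y) mₖ (marked y))))) hi≋lo

    next : ∀ (x : M) → ∃ λ (y : M) → x ⟶ y
    next (mkMarked a i m) with reduced? (a [ i ]%= lower)
    ... | yes red = mkMarked _ (lowered a i) (subst (_∈R v) (sym (removeAt-lowered a i)) m) , record
      { bumps = refl
      ; stays = λ _ → toℕ-lowered a i
      ; moves = contradiction red
      }
    ... | no ¬red = mkMarked _ j (mark (a [ i ]%= lower) (lowered a i) j e m′) , record
      { bumps = refl
      ; stays = λ red → contradiction red ¬red
      ; moves = λ _ j≡i → j≢i (trans j≡i (sym (toℕ-lowered a i)))
      }
      where
      m′ : removeAt (a [ i ]%= lower) (lowered a i) ∈R v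
      m′ = subst (_∈R v) (sym (removeAt-lowered a i)) m
      second = second-mark (a [ i ]%= lower) (lowered a i) ¬red (proj₂ m′)
      j   = proj₁ second
      j≢i = proj₁ (proj₂ second)
      e   = proj₂ (proj₂ second)

    -- Paths to the next reduced word, read in both directions.

    φ-deterministic : ∀ {x x′ y y′ : M} → x ≈ₘ x′ → φ x y → φ x′ y′ → y ≈ₘ y′
    φ-deterministic x≈x′ (stop e _) (stop e′ _) = ⟶-deterministic (⟶-respˡ x≈x′ e) e′
    φ-deterministic x≈x′ (step e ¬red p) (step e′ _ p′) =
      φ-deterministic (⟶-deterministic (⟶-respˡ x≈x′ e) e′) p p′
    φ-deterministic x≈x′ (stop e red) (step e′ ¬red _) =
      contradiction (subst Reduced (proj₁ (⟶-deterministic (⟶-respˡ x≈x′ e) e′)) red) ¬red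
    φ-deterministic x≈x′ (step e′ ¬red _) (stop e red) =
      contradiction (subst Reduced (proj₁ (⟶-deterministic e (⟶-respˡ x≈x′ e′))) red) ¬red

    φ-respʳ : ∀ {x y y′ : M} → y ≈ₘ y′ → φ x y → φ x y′
    φ-respʳ y≈y′ (stop e red)    = stop (⟶-respʳ y≈y′ e) (subst Reduced (proj₁ y≈y′) red)
    φ-respʳ y≈y′ (step e ¬red p) = step e ¬red (φ-respʳ y≈y′ p)

    φ-reduced : ∀ {x y : M} → φ x y → Reduced (word y)
    φ-reduced (stop _ red) = red
    φ-reduced (step _ _ p) = φ-reduced p

    φ-hi : ∀ {x y : M} → φ x y → hiₘ y ≋ loₘ x
    φ-hi (stop e red)    = stay-hi e red
    φ-hi (step e ¬red p) = ≋-trans (φ-hi p) (move-lo e ¬red)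

    -- The path of φ read from its end, to compare two paths with the same end.
    data φ⁻¹ (y x : M) : Set where
      stop : x ⟶ y → Reduced (word x) → φ⁻¹ y x
      step : ∀ {z} → z ⟶ y → ¬ Reduced (word z) → φ⁻¹ z x → φ⁻¹ y x

    φ⁻¹-deterministic : ∀ {y y′ x x′ : M} → y ≈ₘ y′ → φ⁻¹ y x → φ⁻¹ y′ x′ → x ≈ₘ x′
    φ⁻¹-deterministic y≈y′ (stop e _) (stop e′ _) = ⟶-injective (⟶-respʳ y≈y′ e) e′
    φ⁻¹-deterministic y≈y′ (step e ¬red p) (step e′ _ p′) =
      φ⁻¹-deterministic (⟶-injective (⟶-respʳ y≈y′ e) e′) p p′
    φ⁻¹-deterministic y≈y′ (stop e red) (step e′ ¬red _) =
      contradiction (subst Reduced (proj₁ (⟶-injective (⟶-respʳ y≈y′ e) e′)) red) ¬red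
    φ⁻¹-deterministic y≈y′ (step e′ ¬red _) (stop e red) =
      contradiction (subst Reduced (proj₁ (⟶-injective e (⟶-respʳ y≈y′ e′))) red) ¬red

    -- Both relations require the inner vertices to be unreduced, and each requires one end to be
    -- reduced. The accumulator `q` turns the path around, as in list reversal.
    φ⁻¹⇒φ : ∀ {x y : M} → Reduced (word y) → φ⁻¹ y x → φ x y
    φ⁻¹⇒φ {x} {y} red (stop e _)      = stop e red
    φ⁻¹⇒φ {x} {y} red (step e ¬red p) = go p ¬red (stop e red)
      where
      go : ∀ {z} → φ⁻¹ z x → ¬ Reduced (word z) → φ z y → φ x y
      go (stop e _)      ¬red q = step e ¬red q
      go (step e ¬red′ p) ¬red q = go p ¬red′ (step e ¬red q)

    φ⇒φ⁻¹ : ∀ {x y : M} → Reduced (word x) → φ x y → φ⁻¹ y x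
    φ⇒φ⁻¹ {x} {y} red (stop e _)      = stop e red
    φ⇒φ⁻¹ {x} {y} red (step e ¬red p) = go p ¬red (stop e red)
      where
      go : ∀ {z} → φ z y → ¬ Reduced (word z) → φ⁻¹ z x → φ⁻¹ y x
      go (stop e _)       ¬red q = step e ¬red q
      go (step e ¬red′ p) ¬red q = go p ¬red′ (step e ¬red q)

    φ-injective : ∀ {x x′ y y′ : M} → Reduced (word x) → Reduced (word x′) →
                  y ≈ₘ y′ → φ x y → φ x′ y′ → x ≈ₘ x′
    φ-injective red red′ y≈y′ p p′ = φ⁻¹-deterministic y≈y′ (φ⇒φ⁻¹ red p) (φ⇒φ⁻¹ red′ p′)

    -- Orbits are cycles; existence and surjectivity.

    iter : ℕ → M → M
    iter ℕ.zero    x = x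
    iter (ℕ.suc k) x = proj₁ (next (iter k x))

    length-iter : ∀ k x → length (word (iter k x)) ≡ length (word x)
    length-iter ℕ.zero    x = refl
    length-iter (ℕ.suc k) x = trans (cong length (bumps (proj₂ (next (iter k x)))))
      (trans (length-%= (word (iter k x)) (idx (iter k x)) lower) (length-iter k x))

    -- Injectivity peels off the common first steps, so an orbit has no tail leading into its cycle.
    iter-cancel : ∀ k d x → iter k x ≈ₘ iter (k ℕ.+ d) x → x ≈ₘ iter d x
    iter-cancel ℕ.zero    d x e = e
    iter-cancel (ℕ.suc k) d x e = iter-cancel k d x
      (⟶-injective (⟶-respʳ e (proj₂ (next (iter k x)))) (proj₂ (next (iter (k ℕ.+ d) x))))

    encodeₘ : ∀ l (x : M) → length (word x) ≡ l → Fin (n ℕ.^ l ℕ.* l)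
    encodeₘ l x e = combine (encode (word x) l e) (cast e (idx x))

    encodeₘ-injective : ∀ l x y e e′ → encodeₘ l x e ≡ encodeₘ l y e′ → x ≈ₘ y
    encodeₘ-injective l x y e e′ eq =
      let eq₁ , eq₂ = Fin.combine-injective (encode (word x) l e) _ (encode (word y) l e′) _ eq
      in encode-injective (word x) (word y) l e e′ eq₁
       , trans (sym (Fin.toℕ-cast e (idx x))) (trans (cong toℕ eq₂) (Fin.toℕ-cast e′ (idx y)))

    -- Pigeonhole on one more iterate than there are codes; the length of the word never changes.
    -- The `suc` ensures that the return takes at least one step.
    cycle : ∀ x → ∃ λ k → x ≈ₘ iter (ℕ.suc k) x
    cycle x =
      let j , k , j<k , eq = Fin.pigeonhole ℕ.≤-refl code
          d , j+1+d≡k      = ℕ.m≤n⇒∃[o]m+o≡n j<k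
          k≡j+[1+d]        = trans (sym j+1+d≡k) (sym (ℕ.+-suc (toℕ j) d))
      in d , iter-cancel (toℕ j) (ℕ.suc d) x (subst (λ k → iter (toℕ j) x ≈ₘ iter k x) k≡j+[1+d]
           (encodeₘ-injective l (iter (toℕ j) x) (iter (toℕ k) x)
                              (length-iter (toℕ j) x) (length-iter (toℕ k) x) eq))
      where
      l : ℕ
      l = length (word x)
      code : Fin (ℕ.suc (n ℕ.^ l ℕ.* l)) → Fin (n ℕ.^ l ℕ.* l)
      code k = encodeₘ l (iter (toℕ k) x) (length-iter (toℕ k) x)

    abstract
      φ-total : ∀ (x : M) → Reduced (word x) → ∃ λ (y : M) → φ x y
      φ-total x red with cycle x
      ... | k , x≈ with go k
        where
        -- Either a reduced word has been met within `k` steps, or those steps can be prefixed to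
        -- any path from the current vertex. The return to the reduced `x` ends the search.
        go : ∀ k → (∃ λ (y : M) → φ x y) ⊎ (∀ {y} → φ (iter k x) y → φ x y)
        go ℕ.zero    = inj₂ id
        go (ℕ.suc k) with go k
        ... | inj₁ found = inj₁ found
        ... | inj₂ extend with reduced? (word (iter (ℕ.suc k) x))
        ...   | yes red = inj₁ (_ , extend (stop (proj₂ (next (iter k x))) red))
        ...   | no ¬red = inj₂ λ p → extend (step (proj₂ (next (iter k x))) ¬red p)
      ...   | inj₁ found  = found
      ...   | inj₂ extend = _ , extend (stop (proj₂ (next (iter k x))) (subst Reduced (proj₁ x≈) red))

      φ-surjective : ∀ (y : M) → Reduced (word y) → ∃ λ (x : M) → Reduced (word x) × φ x y
      φ-surjective y red with cycle y
      ... | k , y≈ with origin k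
        where
        -- Walking along the cycle from `y`, this remembers the last reduced vertex strictly before
        -- the current one, initially `y`. On return to `y` it is the preimage.
        origin : ∀ k → ∃ λ (x : M) → Reduced (word x) × φ⁻¹ (iter (ℕ.suc k) y) x
        origin ℕ.zero    = y , red , stop (proj₂ (next y)) red
        origin (ℕ.suc k) with reduced? (word (iter (ℕ.suc k) y)) | origin k
        ... | yes red | _ = iter (ℕ.suc k) y , red , stop (proj₂ (next (iter (ℕ.suc k) y))) red
        ... | no ¬red | x , redₓ , p = x , redₓ , step (proj₂ (next (iter (ℕ.suc k) y))) ¬red p
      ...   | x , redₓ , p =
        x , redₓ , φ-respʳ (≈ₘ-sym y (iter (ℕ.suc k) y) y≈) (φ⁻¹⇒φ (subst Reduced (proj₁ y≈) red) p)

      -- Covers of `v` and reduced marked words.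

      -- Exchange between `a` and a reduced word `c` of `v` must delete from `a`: deleting from `c`
      -- would give a word for `w` shorter than its length. Lengths then show that the shortened `a`
      -- is reduced.
      exchange-mark : ∀ a {w p q} → v ⋖ w → w ≈ v ·t[ p , q ] → p < q → a ∈R w →
                      ∃ λ i → removeAt a i ∈R v × Shifted p q (lo a i) (hi a i)
      exchange-mark a {w} {p} {q} (_ , k , (c , (c≗v , red-c) , c≡k) , b , (b≗w , red-b) , b≡1+k)
                    (t , t-refl , w≗vt) p<q (a≗w , red-a)
        with strong-exchange a c (reflection-swaps {t} t-refl) p<q
               (λ m → trans (a≗w m) (trans (w≗vt m) (sym (c≗v (fun t m)))))
      ... | inj₁ (i , σ , e) = i , ((λ m → trans (e m) (c≗v m)) ,
          reduced-transfer c (removeAt a i) e (ℕ.suc-injective |c|≡) red-c) , σ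
        where
        |c|≡ : ℕ.suc (length c) ≡ ℕ.suc (length (removeAt a i))
        |c|≡ = begin
          ℕ.suc (length c)               ≡⟨ cong ℕ.suc c≡k ⟩
          ℕ.suc k                        ≡⟨ b≡1+k ⟨
          length b                       ≡⟨ ℕ.≤-antisym (red-b a λ m → trans (a≗w m) (sym (b≗w m)))
                                                        (red-a b λ m → trans (b≗w m) (sym (a≗w m))) ⟩
          length a                       ≡⟨ length-removeAt′ a i ⟩
          ℕ.suc (length (removeAt a i))  ∎
          where open ≡-Reasoning
      ... | inj₂ (j , e) = contradiction (begin-strict
          length (removeAt c j)  <⟨ length-removeAt< c j ⟩
          length c               ≡⟨ c≡k ⟩
          k                      <⟨ ℕ.n<1+n k ⟩
          ℕ.suc k                ≡⟨ b≡1+k ⟨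
          length b               ≤⟨ red-b (removeAt c j) (λ m → trans (e m) (trans (a≗w m) (sym (b≗w m)))) ⟩
          length (removeAt c j)  ∎) (ℕ.<-irrefl refl)
        where open ℕ.≤-Reasoning

    -- The converse of `exchange-mark`. The pair is free up to a common shift, so that `r` itself,
    -- and not just a congruent integer, can be an index of the reflection.
    cover : ∀ (x : M) {p q} → Reduced (word x) → Shifted p q (loₘ x) (hiₘ x) →
            p < q × affine (word x) ≈ v ·t[ p , q ] × v ⋖ affine (word x)
    cover (mkMarked a i m@(e , red-i)) {p} {q} red σ =
        shifted-< (shifted-sym σ) (reduced⇒positive a red i)
      , vt
      , (p , q , vt)
      , length (removeAt a i) , (removeAt a i , m , refl)
      , (a , ((λ _ → refl) , red) , length-removeAt′ a i)
      where
      vt : affine a ≈ v ·t[ p , q ]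
      vt = affine (crossing a i)
         , swaps-reflection (swaps-shift (shifted-sym σ) (crossing-swaps a i))
         , λ m → trans (sym (removeAt-crossing a i m)) (e _)

    -- The bijection between the two sets of reduced words.

    module _ (r : ℤ) where

      Carrier⁺ Carrier⁻ : Set
      Carrier⁺ = Setoid.Carrier (R (Ψ⁺ v r))
      Carrier⁻ = Setoid.Carrier (R (Ψ⁻ v r))

      m⁺ : UniquelyMarked v (Ψ⁺ v r)
      m⁺ (a , w , (v⋖w , q , r<q , w≈) , a∈R) =
        let i , mᵢ , _ = exchange-mark a {w} v⋖w w≈ r<q a∈R
        in i , mᵢ , λ {j} mⱼ → Fin.toℕ-injective (reduced-marks a i j (proj₂ a∈R) mᵢ mⱼ)

      m⁻ : UniquelyMarked v (Ψ⁻ v r)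
      m⁻ (a , w , (v⋖w , q , q<r , w≈) , a∈R) =
        let i , mᵢ , _ = exchange-mark a {w} v⋖w w≈ q<r a∈R
        in i , mᵢ , λ {j} mⱼ → Fin.toℕ-injective (reduced-marks a i j (proj₂ a∈R) mᵢ mⱼ)

      regard⁺ : Carrier⁺ → M
      regard⁺ = regard m⁺

      regard⁻ : Carrier⁻ → M
      regard⁻ = regard m⁻

      lo-regard : ∀ a → loₘ (regard⁺ a) ≋ r
      lo-regard (a , w , (v⋖w , q , r<q , w≈) , a∈R) =
        let _ , _ , σ = exchange-mark a {w} v⋖w w≈ r<q a∈R in shifted⇒≋ σ

      hi-regard : ∀ a → hiₘ (regard⁻ a) ≋ r
      hi-regard (a , w , (v⋖w , q , q<r , w≈) , a∈R) =
        let _ , _ , σ = exchange-mark a {w} v⋖w w≈ q<r a∈R in shifted⇒≋ (shifted-swap σ)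

      red⁺ : ∀ a → Reduced (word (regard⁺ a))
      red⁺ (a , w , _ , _ , red) = red

      red⁻ : ∀ a → Reduced (word (regard⁻ a))
      red⁻ (a , w , _ , _ , red) = red

      unregard⁺ : ∀ (x : M) → Reduced (word x) → loₘ x ≋ r → Carrier⁺
      unregard⁺ x red (by k e) =
        -- Shifting both wires by `- k` turns moves the lower one to `r`; `refl` takes the shifted
        -- upper one as `q`.
        let r<q , vt , v⋖w = cover x red (shifted-sym (by (- k) (unshift k e) refl))
        in word x , affine (word x) , (v⋖w , _ , r<q , vt) , (λ _ → refl) , red

      unregard⁻ : ∀ (x : M) → Reduced (word x) → hiₘ x ≋ r → Carrier⁻
      unregard⁻ x red (by k e) =
        let q<r , vt , v⋖w = cover x red (shifted-sym (by (- k) refl (unshift k e)))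
        in word x , affine (word x) , (v⋖w , _ , q<r , vt) , (λ _ → refl) , red

      image : ∀ a → ∃ λ (y : M) → φ (regard⁺ a) y
      image a = φ-total (regard⁺ a) (red⁺ a)

      to : Carrier⁺ → Carrier⁻
      to a = let y , p = image a in unregard⁻ y (φ-reduced p) (≋-trans (φ-hi p) (lo-regard a))

      regard-to : ∀ a → proj₁ (image a) ≈ₘ regard m⁻ (to a)
      regard-to a = reduced-≈ₘ (proj₁ (image a)) (regard⁻ (to a)) (φ-reduced (proj₂ (image a))) refl

      -- Allowing any `x` with the word of `a` is harmless, since a reduced word has one mark, and
      -- covers both congruence and surjectivity.
      to-unique : ∀ a (x : M) {y : M} → word (regard⁺ a) ≡ word x → φ x y → proj₁ (to a) ≡ word y
      to-unique a x e p = proj₁ (φ-deterministic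
        (reduced-≈ₘ (regard⁺ a) x (red⁺ a) e) (proj₂ (image a)) p)

      bijection : Bijection (R (Ψ⁺ v r)) (R (Ψ⁻ v r))
      bijection = record
        { to        = to
        ; cong      = λ {a} {b} e → to-unique a (regard⁺ b) e (proj₂ (image b))
        ; bijective = injective , surjective
        }
        where
        injective : ∀ {a b : Carrier⁺} → proj₁ (to a) ≡ proj₁ (to b) → proj₁ a ≡ proj₁ b
        injective {a} {b} e = proj₁ (φ-injective (red⁺ a) (red⁺ b)
          (reduced-≈ₘ (proj₁ (image a)) (proj₁ (image b)) (φ-reduced (proj₂ (image a))) e) (proj₂ (image a)) (proj₂ (image b)))
        surjective : ∀ c → ∃ λ a → ∀ {b : Carrier⁺} → proj₁ b ≡ proj₁ a → proj₁ (to b) ≡ proj₁ c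
        surjective c =
          let x , red , p = φ-surjective (regard⁻ c) (red⁻ c)
          in unregard⁺ x red (≋-trans (≋-sym (φ-hi p)) (hi-regard c))
           , λ {b} e → to-unique b x e p

      graph : ∀ a (y : MarkedWord v) → φ (regard m⁺ a) y ⇔ (y ≈ₘ regard m⁻ (to a))
      graph a y = mk⇔
        (λ p → ≈ₘ-trans y z y⁻ (φ-deterministic (≈ₘ-refl (regard m⁺ a)) p (proj₂ (image a))) (regard-to a))
        (λ e → φ-respʳ (≈ₘ-trans z y⁻ y (regard-to a) (≈ₘ-sym y y⁻ e)) (proj₂ (image a)))
        where
        z y⁻ : MarkedWord v
        z  = proj₁ (image a)
        y⁻ = regard m⁻ (to a)

theorem11 : (n : ℕ) → 2 ≤ n → (v : Affine n) (r : ℤ) →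
    Σ[ m⁺ ∈ UniquelyMarked v (Ψ⁺ v r) ]
    Σ[ m⁻ ∈ UniquelyMarked v (Ψ⁻ v r) ]
    Σ[ φᵣ ∈ Bijection (R (Ψ⁺ v r)) (R (Ψ⁻ v r)) ]
    (∀ a (y : MarkedWord v) → φ (regard m⁺ a) y ⇔ (y ≈ₘ regard m⁻ (Bijection.to φᵣ a)))
theorem11 n 2≤n v r = m⁺ n 2≤n v r , m⁻ n 2≤n v r , bijection n 2≤n v r , graph n 2≤n v r
  where open AffineWords
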